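{- Let $q$ be a power of an odd prime $p$ and let $K$ be a proper subfield of $\mathbb{F}_q$. Let $d \geq 2$ be a divisor of $\frac{q-1}{|K|-1}$ such that $q< d|K|(|K|+1)$. Let $r$ be the remainder of $\frac{q-1}{d}$ divided by $p|K|$. If $r<(p-1)|K|$, then $\omega(GP(q,d))=|K|$.
   Context: $\mathbb{F}_q$ is the finite field with $q$ elements and $\mathbb{F}_q^*=\mathbb{F}_q\setminus\{0\}$. For an integer $d>1$ and an odd prime power $q\equiv 1\pmod{2d}$ (this congruence holds automatically under the hypotheses of the claim), the $d$-Paley graph $GP(q,d)$ is the graph with vertex set $\mathbb{F}_q$ in which two vertices are adjacent if and only if their difference lies in $(\mathbb{F}_q^*)^d=\{x^d: x\in\mathbb{F}_q^*\}$. The clique number $\omega(X)$ of a graph $X$ is the maximum number of vertices of a complete subgraph of $X$. The remainder $r$ is the integer with $0\le r<p|K|$ and $r\equiv \frac{q-1}{d}\pmod{p|K|}$. -}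

module Defs where

open import Algebra.Bundles using (CommutativeRing)
import Algebra.Properties.Semiring.Exp as Exp
open import Data.Fin.Base using (Fin; zero; suc)
open import Data.Nat.Base using (ℕ; zero; suc; _∸_; _≤_; NonZero)
import Data.Nat.Base as ℕ
open import Data.Nat.Primality using (Prime; prime⇒nonZero)
open import Data.Nat.Properties using (m*n≢0)
open import Data.Product.Base using (Σ; ∃-syntax; _×_; _,_; proj₁)
open import Function.Bundles using (Inverse)
open import Function.Definitions using (Injective)
open import Level using (Level; _⊔_) renaming (suc to lsuc)
open import Relation.Binary.Bundles using (Setoid)
open import Relation.Binary.Core using (Rel)
import Relation.Binary.Construct.On as On
open import Relation.Binary.PropositionalEquality.Core using (_≡_; _≢_; refl)
import Relation.Binary.PropositionalEquality.Properties as ≡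
open import Relation.Nullary.Negation.Core using (¬_; contradiction)
open import Relation.Unary using (Pred)

HasCardinality : {a ℓ : Level} → Setoid a ℓ → ℕ → Set (a ⊔ ℓ)
HasCardinality S n = Inverse S (≡.setoid (Fin n))

record Field (c ℓ : Level) : Set (lsuc (c ⊔ ℓ)) where
  field
    commutativeRing : CommutativeRing c ℓ

  open CommutativeRing commutativeRing public

  field
    1≉0     : ¬ (1# ≈ 0#)
    inverse : (x : Carrier) → ¬ (x ≈ 0#) → ∃[ y ] x * y ≈ 1#

record Subfield {c ℓ : Level} (F : Field c ℓ) (s : Level) : Set (c ⊔ ℓ ⊔ lsuc s) where
  open Field F
  field
    _∈K        : Pred Carrier s
    resp       : {x y : Carrier} → x ≈ y → x ∈K → y ∈K
    0#-closed  : 0# ∈K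
    1#-closed  : 1# ∈K
    +-closed   : {x y : Carrier} → x ∈K → y ∈K → (x + y) ∈K
    neg-closed : {x : Carrier} → x ∈K → (- x) ∈K
    *-closed   : {x y : Carrier} → x ∈K → y ∈K → (x * y) ∈K
    -- In a field, x * y ≈ 1# says that y is the inverse of x.
    inv-closed : {x y : Carrier} → x ∈K → x * y ≈ 1# → y ∈K

  -- Elements are compared by their values in F; membership proofs are ignored.
  elements : Setoid (c ⊔ s) ℓ
  elements = On.setoid {B = Σ Carrier _∈K} setoid proj₁

  IsProper : Set (c ⊔ s)
  IsProper = ∃[ x ] ¬ (x ∈K)

-- Symmetry and looplessness of the adjacency relation are not recorded:
-- a clique requires adjacency of its distinct vertices in both directions.
record Graph (a ℓ e : Level) : Set (lsuc (a ⊔ ℓ ⊔ e)) where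
  field
    vertices : Setoid a ℓ

  open Setoid vertices public using () renaming (Carrier to Vertex; _≈_ to _≈ᵥ_)

  field
    Adjacent : Rel Vertex e

record Clique {a ℓ e : Level} (G : Graph a ℓ e) (m : ℕ) : Set (a ⊔ ℓ ⊔ e) where
  open Graph G
  field
    vertex    : Fin m → Vertex
    injective : Injective _≡_ _≈ᵥ_ vertex
    adjacent  : {i j : Fin m} → i ≢ j → Adjacent (vertex i) (vertex j)

HasCliqueNumber : {a ℓ e : Level} → Graph a ℓ e → ℕ → Set (a ⊔ ℓ ⊔ e)
HasCliqueNumber G w = Clique G w × ((m : ℕ) → Clique G m → m ≤ w)

module _ {c ℓ : Level} (F : Field c ℓ) where
  open Field F
  open Exp semiring using (_^_)

  IsNonzeroPower : ℕ → Pred Carrier (c ⊔ ℓ)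
  IsNonzeroPower d a = ∃[ x ] (¬ (x ≈ 0#) × a ≈ x ^ d)

  -- When F has q elements and 2 * d divides q ∸ 1, the element - 1# is a
  -- d-th power, so adjacency is symmetric.
  GP : ℕ → Graph c ℓ (c ⊔ ℓ)
  GP d = record
    { vertices = setoid
    ; Adjacent = λ u v → IsNonzeroPower d (u - v)
    }

module _ {c ℓ s : Level} {F : Field c ℓ} (K : Subfield F s) where
  open Field F using (_≈_; 0#; 1#; 1≉0; sym; trans)
  open Subfield K

  cardinality∸1≢0 : {k : ℕ} → HasCardinality elements k → NonZero (k ∸ 1)
  cardinality∸1≢0 {zero} I = contradiction (Inverse.to I (_ , 0#-closed)) λ ()
  cardinality∸1≢0 {suc zero} I = contradiction 1≈0 1≉0
    where
    zero-unique : (i : Fin 1) → zero ≡ i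
    zero-unique zero = refl

    1≈0 : 1# ≈ 0#
    1≈0 = trans (sym (Inverse.inverseʳ I {_ , 1#-closed} (zero-unique _)))
                (Inverse.inverseʳ I {_ , 0#-closed} (zero-unique _))
  cardinality∸1≢0 {suc (suc _)} _ = _

  cardinality≢0 : {k : ℕ} → HasCardinality elements k → NonZero k
  cardinality≢0 {zero} I = contradiction (Inverse.to I (_ , 0#-closed)) λ ()
  cardinality≢0 {suc _} _ = _

  p*cardinality≢0 : {p k : ℕ} → Prime p → HasCardinality elements k → NonZero (p ℕ.* k)
  p*cardinality≢0 {p} {k} pr I = m*n≢0 p k {{prime⇒nonZero pr}} {{cardinality≢0 I}}

{-# OPTIONS --safe #-}

-- K* consists of d-th powers because |K| − 1 divides (q − 1) / d, so K is a clique.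
-- The bound for an arbitrary clique is Stepanov's polynomial method in the form of
-- Hanson and Petridis. Polynomials are replaced throughout by the dual objects, finite
-- combinations f ↦ Σ w i f (a i) of evaluations at distinct points, which are governed by
-- their moments Σ w i (a i) ^ l and exist with any prescribed initial moments. Root
-- counting amounts to the choice of suitable moments. In particular x ↦ x ^ |K| is additive
-- on F without knowing that |K| is a power of p, and this additivity replaces Lucas' theorem.
module Submission where

open import Algebra.Bundles using (Monoid)
import Algebra.Properties.CommutativeMonoid.Sum as CommutativeMonoidSum
import Algebra.Properties.CommutativeSemiring.Exp as Exp
import Algebra.Properties.Monoid.Mult as MonoidMult
import Algebra.Properties.Ring as RingProperties
import Algebra.Properties.Semiring.Mult as Mult
import Algebra.Properties.Semiring.Sum as Sum
import Algebra.Solver.Ring.NaturalCoefficients.Default as SemiringSolver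
open import Data.Fin.Base using (Fin; zero; suc; inject≤; punchIn)
open import Data.Fin.Permutation using (Permutation; permutation; _⟨$⟩ʳ_; remove; punchIn-permute)
open import Data.Fin.Properties using (_≟_; any?; inject≤-injective; punchIn-injective; punchInᵢ≢i; suc-injective)
open import Data.Nat.Base using (ℕ; zero; suc; _∸_; _/_; _%_; _≤_; _<_; z≤n; z<s; s<s; s<s⁻¹; NonZero; >-nonZero; >-nonZero⁻¹; ≢-nonZero⁻¹)
import Data.Nat.Base as ℕ
open import Data.Nat.DivMod using (m≡m%n+[m/n]*n; m%n<n; m<n*o⇒m/o<n; m<n⇒m%n≡m; m≥n⇒m/n>0; m*n/n≡m; m/n*n≡m; [m+kn]%n≡m%n)
open import Data.Nat.Divisibility using (_∣_; divides; ∣⇒≤)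
open import Data.Nat.GCD using (gcd; gcd-GCD; gcd[m,n]∣m; gcd[m,n]∣n; gcd[m,n]≢0; module Bézout)
open import Data.Nat.Primality using (Prime; prime⇒irreducible)
import Data.Nat.Properties as ℕ
open import Data.Nat.Properties using (<⇒≤)
open import Data.Product.Base using (∃-syntax; _,_; proj₁; proj₂)
open import Data.Sum.Base using (inj₁; inj₂)
open import Data.Unit.Base using (⊤)
open import Data.Vec.Functional using (Vector; _∷_)
open import Function.Base using (_∘_)
open import Function.Bundles using (Inverse)
open import Level using (Level; 0ℓ)
open import Relation.Binary.Definitions using (Decidable)
open import Relation.Binary.PropositionalEquality.Core as ≡ using (_≡_; _≢_)
open import Relation.Binary.PropositionalEquality.Properties using (module ≡-Reasoning)
open import Relation.Nullary.Decidable using (yes; no; map′)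
open import Relation.Nullary.Negation using (¬_; contradiction)
open import Defs

-- Remainders and Bézout's identity.

-- Adding to `n` the complement of its remainder completes the last block. The excess is positive
-- even when `k` divides `n`, since it is then `k`.
next-multiple : ∀ n k .{{_ : NonZero k}} → k ℕ.* suc (n / k) ≡ n ℕ.+ (k ∸ n % k)
next-multiple n k = begin
  k ℕ.* suc (n / k)                         ≡⟨ ℕ.*-comm k (suc (n / k)) ⟩
  k ℕ.+ n / k ℕ.* k                         ≡⟨ ≡.cong (ℕ._+ n / k ℕ.* k) (ℕ.m∸n+n≡m (ℕ.<⇒≤ (m%n<n n k))) ⟨
  (k ∸ n % k) ℕ.+ n % k ℕ.+ n / k ℕ.* k     ≡⟨ ℕ.+-assoc (k ∸ n % k) (n % k) (n / k ℕ.* k) ⟩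
  (k ∸ n % k) ℕ.+ (n % k ℕ.+ n / k ℕ.* k)   ≡⟨ ≡.cong ((k ∸ n % k) ℕ.+_) (m≡m%n+[m/n]*n n k) ⟨
  (k ∸ n % k) ℕ.+ n                         ≡⟨ ℕ.+-comm (k ∸ n % k) n ⟩
  n ℕ.+ (k ∸ n % k)                         ∎
  where open ≡-Reasoning

module _ {a ℓ} (M : Monoid a ℓ) where
  open Monoid M
  open MonoidMult M using (×-homo-+; ×-congˡ) renaming (_×_ to _·_)
  open import Relation.Binary.Reasoning.Setoid setoid

  -- Bézout's identity without subtraction reads g + u = v with u and v multiples of `m` and `n` in
  -- some order. Both multiples annihilate `x`, hence so does g. In the multiplicative monoid this
  -- concerns roots of unity, in the additive one the characteristic.
  gcd-kills : ∀ {x} m n → m · x ≈ ε → n · x ≈ ε → gcd m n · x ≈ ε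
  gcd-kills {x} m n mx≈ε nx≈ε = cases (Bézout.identity (gcd-GCD m n))
    where
    multiple-kills : ∀ u v → v · x ≈ ε → (u ℕ.* v) · x ≈ ε
    multiple-kills zero    v vx≈ε = refl
    multiple-kills (suc u) v vx≈ε = begin
      (v ℕ.+ u ℕ.* v) · x      ≈⟨ ×-homo-+ x v (u ℕ.* v) ⟩
      v · x ∙ (u ℕ.* v) · x    ≈⟨ ∙-cong vx≈ε (multiple-kills u v vx≈ε) ⟩
      ε ∙ ε                    ≈⟨ identityˡ ε ⟩
      ε                        ∎

    difference-kills : ∀ g u v → g ℕ.+ u ≡ v → u · x ≈ ε → v · x ≈ ε → g · x ≈ ε
    difference-kills g u v eq ux≈ε vx≈ε = begin
      g · x              ≈⟨ identityʳ _ ⟨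
      g · x ∙ ε          ≈⟨ ∙-congˡ ux≈ε ⟨
      g · x ∙ u · x      ≈⟨ ×-homo-+ x g u ⟨
      (g ℕ.+ u) · x      ≈⟨ ×-congˡ eq ⟩
      v · x              ≈⟨ vx≈ε ⟩
      ε                  ∎

    cases : Bézout.Identity (gcd m n) m n → gcd m n · x ≈ ε
    cases (Bézout.+- u v eq) =
      difference-kills (gcd m n) (v ℕ.* n) (u ℕ.* m) eq (multiple-kills v n nx≈ε) (multiple-kills u m mx≈ε)
    cases (Bézout.-+ u v eq) =
      difference-kills (gcd m n) (u ℕ.* m) (v ℕ.* n) eq (multiple-kills u m mx≈ε) (multiple-kills v n nx≈ε)

-- Products and powers in a field.

module FieldProperties {f ℓ} (F : Field f ℓ) where
  open Field F hiding (zero)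
  open Exp commutativeSemiring
  open Mult semiring using (×1-homo-*; ×-homo-1) renaming (_×_ to _·_)
  open Sum semiring
  open RingProperties ring
  open SemiringSolver commutativeSemiring using (solve; _:+_; _:*_; _:=_; con)
  open import Relation.Binary.Reasoning.Setoid setoid

  *-cancelˡ-nonzero : ∀ {x y z} → ¬ (x ≈ 0#) → x * y ≈ x * z → y ≈ z
  *-cancelˡ-nonzero {x} {y} {z} x≉0 xy≈xz = begin
    y              ≈⟨ insert y ⟩
    x⁻¹ * (x * y)  ≈⟨ *-congˡ xy≈xz ⟩
    x⁻¹ * (x * z)  ≈⟨ insert z ⟨
    z              ∎
    where
    x⁻¹ = proj₁ (inverse x x≉0)

    insert : ∀ w → w ≈ x⁻¹ * (x * w)
    insert w = begin
      w              ≈⟨ *-identityˡ w ⟨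
      1# * w         ≈⟨ *-congʳ (proj₂ (inverse x x≉0)) ⟨
      x * x⁻¹ * w    ≈⟨ solve 3 (λ a b e → a :* b :* e := b :* (a :* e)) refl x x⁻¹ w ⟩
      x⁻¹ * (x * w)  ∎

  *-nonzero : ∀ {x y} → ¬ (x ≈ 0#) → ¬ (y ≈ 0#) → ¬ (x * y ≈ 0#)
  *-nonzero x≉0 y≉0 xy≈0 = y≉0 (*-cancelˡ-nonzero x≉0 (trans xy≈0 (sym (zeroʳ _))))

  ^-nonzero : ∀ {x} n → ¬ (x ≈ 0#) → ¬ (x ^ n ≈ 0#)
  ^-nonzero zero    x≉0 = 1≉0
  ^-nonzero (suc n) x≉0 = *-nonzero x≉0 (^-nonzero n x≉0)

  0^ : ∀ n → 0 < n → 0# ^ n ≈ 0#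
  0^ (suc n) _ = zeroˡ _

  1^ : ∀ n → 1# ^ n ≈ 1#
  1^ zero    = refl
  1^ (suc n) = trans (*-identityˡ _) (1^ n)

  -- The image of `p ^ n` in F is the n-th power of the image of `p`. Since q vanishes in F, this
  -- forces the characteristic to be the prime of which q is a power.
  ×1-^-nonzero : ∀ p n → ¬ (p · 1# ≈ 0#) → ¬ ((p ℕ.^ n) · 1# ≈ 0#)
  ×1-^-nonzero p zero    p≉0 eq = 1≉0 (trans (sym (+-identityʳ 1#)) eq)
  ×1-^-nonzero p (suc n) p≉0 eq =
    *-nonzero p≉0 (×1-^-nonzero p n p≉0) (trans (sym (×1-homo-* p (p ℕ.^ n))) eq)

  -- Moments of combinations of evaluations.

  Distinct : ∀ {n} → Vector Carrier n → Set ℓ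
  Distinct a = ∀ {i j} → i ≢ j → ¬ (a i ≈ a j)

  moment : ∀ {n} → Vector Carrier n → Vector Carrier n → ℕ → Carrier
  moment {n} w a l = ∑[ i < n ] (w i * a i ^ l)

  moment-suc : ∀ {n} (w a : Vector Carrier n) l →
               moment w a (suc l) ≈ moment (λ i → w i * a i) a l
  moment-suc w a l = sum-cong-≋ (λ i → sym (*-assoc (w i) (a i) (a i ^ l)))

  -- Subtracting a 0 times each equation from the next one eliminates w 0 and leaves
  -- a system of the same shape in the unknowns w i (a i − a 0), i > 0.
  vandermonde : ∀ {n} (a : Vector Carrier n) → Distinct a → (y : ℕ → Carrier) →
                ∃[ w ] (∀ {l} → l < n → moment {n} w a l ≈ y l)
  vandermonde {zero}  a distinct y = (λ ()) , λ ()
  vandermonde {suc n} a distinct y = w , moments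
    where
    a₀ = a zero
    a₊ = a ∘ suc

    reduced = vandermonde a₊ (λ i≢j → distinct (i≢j ∘ suc-injective))
                          (λ l → y (suc l) - a₀ * y l)
    w′ = proj₁ reduced

    gap : (i : Fin n) → ∃[ v ] ((a₊ i - a₀) * v ≈ 1#)
    gap i = inverse (a₊ i - a₀) (λ eq → distinct (λ ()) (x∙y⁻¹≈ε⇒x≈y _ _ eq))

    w₊ : Vector Carrier n
    w₊ i = w′ i * proj₁ (gap i)

    -- The weight at `a₀` drops out of the eliminated system, so it is free to be chosen last, to
    -- correct the moment of order 0.
    w : Vector Carrier (suc n)
    w = (y 0 - moment w₊ a₊ 0) ∷ w₊

    split : ∀ i l → w₊ i * a₊ i ^ suc l ≈ a₀ * (w₊ i * a₊ i ^ l) + w′ i * a₊ i ^ l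
    split i l = begin
      w′ i * v * (a₊ i * A)
        ≈⟨ *-congˡ (*-congʳ (//-rightDividesˡ a₀ (a₊ i))) ⟨
      w′ i * v * ((a₊ i - a₀ + a₀) * A)
        ≈⟨ solve 5 (λ w v e a A → w :* v :* ((e :+ a) :* A)
                                  := a :* (w :* v :* A) :+ (e :* v) :* (w :* A))
                   refl (w′ i) v (a₊ i - a₀) a₀ A ⟩
      a₀ * (w′ i * v * A) + ((a₊ i - a₀) * v) * (w′ i * A)
        ≈⟨ +-congˡ (trans (*-congʳ (proj₂ (gap i))) (*-identityˡ _)) ⟩
      a₀ * (w′ i * v * A) + w′ i * A  ∎
      where
      v = proj₁ (gap i)
      A = a₊ i ^ l

    recurrence : ∀ l → moment w a (suc l) ≈ a₀ * moment w a l + moment w′ a₊ l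
    recurrence l = begin
      w zero * (a₀ * a₀ ^ l) + ∑[ i < n ] (w₊ i * a₊ i ^ suc l)
        ≈⟨ +-congˡ (trans (sum-cong-≋ (λ i → split i l)) (∑-distrib-+ {n} (λ i → a₀ * (w₊ i * a₊ i ^ l)) (λ i → w′ i * a₊ i ^ l))) ⟩
      w zero * (a₀ * a₀ ^ l) + (∑[ i < n ] (a₀ * (w₊ i * a₊ i ^ l)) + moment w′ a₊ l)
        ≈⟨ +-congˡ (+-congʳ (*-distribˡ-sum {n} a₀ (λ i → w₊ i * a₊ i ^ l))) ⟨
      w zero * (a₀ * a₀ ^ l) + (a₀ * moment w₊ a₊ l + moment w′ a₊ l)
        ≈⟨ solve 5 (λ w a A M N → w :* (a :* A) :+ (a :* M :+ N)
                                  := a :* (w :* A :+ M) :+ N)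
                   refl (w zero) a₀ (a₀ ^ l) (moment w₊ a₊ l) (moment w′ a₊ l) ⟩
      a₀ * moment w a l + moment w′ a₊ l  ∎

    moments : ∀ {l} → l < suc n → moment w a l ≈ y l
    moments {zero}  _ = trans (+-congʳ (*-identityʳ _)) (//-rightDividesˡ _ (y 0))
    moments {suc l} l<n = begin
      moment w a (suc l)                       ≈⟨ recurrence l ⟩
      a₀ * moment w a l + moment w′ a₊ l       ≈⟨ +-cong (*-congˡ (moments (ℕ.m<n⇒m<1+n (s<s⁻¹ l<n))))
                                                         (proj₂ reduced (s<s⁻¹ l<n)) ⟩
      a₀ * y l + (y (suc l) - a₀ * y l)        ≈⟨ +-comm _ _ ⟩
      y (suc l) - a₀ * y l + a₀ * y l          ≈⟨ //-rightDividesˡ _ _ ⟩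
      y (suc l)                                ∎

  -- One factor `a i + z` is split off. Its summand `a i` is absorbed into the weights, which shifts
  -- the moments by one; this is why the inductions below let the weights vary.
  moment-translate-suc : ∀ {n} (w a : Vector Carrier n) z l →
    moment w (λ i → a i + z) (suc l)
      ≈ moment (λ i → w i * a i) (λ i → a i + z) l + z * moment w (λ i → a i + z) l
  moment-translate-suc {n} w a z l = begin
    ∑[ i < n ] (w i * ((a i + z) * (a i + z) ^ l))
      ≈⟨ sum-cong-≋ (λ i → solve 4 (λ w a z A → w :* ((a :+ z) :* A) := w :* a :* A :+ z :* (w :* A))
                                   refl (w i) (a i) z ((a i + z) ^ l)) ⟩
    ∑[ i < n ] (w i * a i * (a i + z) ^ l + z * (w i * (a i + z) ^ l))
      ≈⟨ ∑-distrib-+ {n} (λ i → w i * a i * (a i + z) ^ l) (λ i → z * (w i * (a i + z) ^ l)) ⟩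
    moment (λ i → w i * a i) (λ i → a i + z) l + ∑[ i < n ] (z * (w i * (a i + z) ^ l))
      ≈⟨ +-congˡ (*-distribˡ-sum {n} z (λ i → w i * (a i + z) ^ l)) ⟨
    moment (λ i → w i * a i) (λ i → a i + z) l + z * moment w (λ i → a i + z) l  ∎

  -- In the binomial expansion of `(a i + z) ^ l` every term except the top one contributes a moment
  -- of order below `l`.
  moment-translate : ∀ {n} (w a : Vector Carrier n) z l →
    (∀ {j} → j < l → moment w a j ≈ 0#) →
    moment w (λ i → a i + z) l ≈ moment w a l
  moment-translate w a z zero    vanish = refl
  moment-translate w a z (suc l) vanish = begin
    moment w (λ i → a i + z) (suc l)
      ≈⟨ moment-translate-suc w a z l ⟩
    moment (λ i → w i * a i) (λ i → a i + z) l + z * moment w (λ i → a i + z) l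
      ≈⟨ +-cong (moment-translate (λ i → w i * a i) a z l
                  (λ {j} j<l → trans (sym (moment-suc w a j)) (vanish (s<s j<l))))
                (*-congˡ (trans (moment-translate w a z l (vanish ∘ ℕ.m<n⇒m<1+n))
                                (vanish (ℕ.n<1+n l)))) ⟩
    moment (λ i → w i * a i) a l + z * 0#
      ≈⟨ +-cong (sym (moment-suc w a l)) (zeroʳ z) ⟩
    moment w a (suc l) + 0#
      ≈⟨ +-identityʳ _ ⟩
    moment w a (suc l)  ∎

  -- Here two terms of the binomial expansion survive; the factor `suc l · 1#` is the binomial
  -- coefficient of the second one.
  moment-translate-lead : ∀ {n} (w a : Vector Carrier n) z l →
    (∀ {j} → j < l → moment w a j ≈ 0#) →
    moment w (λ i → a i + z) (suc l)
      ≈ moment w a (suc l) + (suc l · 1#) * (z * moment w a l)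
  moment-translate-lead w a z zero vanish = begin
    moment w (λ i → a i + z) 1
      ≈⟨ moment-translate-suc w a z 0 ⟩
    moment (λ i → w i * a i) a 0 + z * moment w a 0
      ≈⟨ +-cong (moment-suc w a 0) (trans (*-congʳ (×-homo-1 1#)) (*-identityˡ _)) ⟨
    moment w a 1 + (1 · 1#) * (z * moment w a 0)  ∎
  moment-translate-lead w a z (suc l) vanish = begin
    moment w (λ i → a i + z) (suc (suc l))
      ≈⟨ moment-translate-suc w a z (suc l) ⟩
    moment wa (λ i → a i + z) (suc l) + z * moment w (λ i → a i + z) (suc l)
      ≈⟨ +-cong (moment-translate-lead wa a z l
                  (λ {j} j<l → trans (sym (moment-suc w a j)) (vanish (s<s j<l))))
                (*-congˡ (moment-translate w a z (suc l) vanish)) ⟩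
    moment wa a (suc l) + T * (z * moment wa a l) + z * moment w a (suc l)
      ≈⟨ +-congʳ (+-cong (moment-suc w a (suc l)) (*-congˡ (*-congˡ (moment-suc w a l)))) ⟨
    moment w a (suc (suc l)) + T * (z * moment w a (suc l)) + z * moment w a (suc l)
      ≈⟨ solve 3 (λ M T N → M :+ T :* N :+ N := M :+ (con 1 :+ T) :* N)
                 refl (moment w a (suc (suc l))) T (z * moment w a (suc l)) ⟩
    moment w a (suc (suc l)) + (suc (suc l) · 1#) * (z * moment w a (suc l))  ∎
    where
    wa = λ i → w i * a i
    T = suc l · 1#

  moment-const : ∀ {n} (w a : Vector Carrier n) l {s} → (∀ i → a i ^ l ≈ s) →
                 moment w a l ≈ moment w a 0 * s
  moment-const {n} w a l {s} const = begin
    moment w a l                  ≈⟨ sum-cong-≋ (λ i → *-cong (sym (*-identityʳ (w i))) (const i)) ⟩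
    ∑[ i < n ] (w i * 1# * s)     ≈⟨ *-distribʳ-sum s (λ i → w i * 1#) ⟨
    moment w a 0 * s              ∎

  -- Kronecker's delta. A combination of evaluations at more than m points with moments `δ m` reads
  -- off the coefficient of X^m from polynomials of degree less than the number of points.
  δ : ℕ → ℕ → Carrier
  δ zero    zero    = 1#
  δ zero    (suc _) = 0#
  δ (suc _) zero    = 0#
  δ (suc m) (suc l) = δ m l

  δ-refl : ∀ m → δ m m ≈ 1#
  δ-refl zero    = refl
  δ-refl (suc m) = δ-refl m

  δ-< : ∀ {m l} → l < m → δ m l ≈ 0#
  δ-< {suc m} {zero}  _   = refl
  δ-< {suc m} {suc l} l<m = δ-< (s<s⁻¹ l<m)

  -- Given `n + 1` roots, the combination supported on them that extracts the coefficient of X^n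
  -- sends X^n to 1. But X^n equals the constant `s` there, and constants are sent to 0.
  roots≤exponent : ∀ {m} (a : Vector Carrier m) → Distinct a →
                   ∀ {n} {s} → 0 < n → (∀ i → a i ^ n ≈ s) → m ≤ n
  roots≤exponent {m} a distinct {n} {s} 0<n roots = ℕ.≮⇒≥ λ n<m → 1≉0 (too-many n<m)
    where
    too-many : n < m → 1# ≈ 0#
    too-many n<m = begin
      1#                  ≈⟨ δ-refl n ⟨
      δ n n               ≈⟨ moments (ℕ.n<1+n n) ⟨
      moment w a′ n       ≈⟨ moment-const w a′ n (λ i → roots (inject≤ i n<m)) ⟩
      moment w a′ 0 * s   ≈⟨ *-congʳ (trans (moments z<s) (δ-< 0<n)) ⟩
      0# * s              ≈⟨ zeroˡ s ⟩
      0#                  ∎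
      where
      a′ : Vector Carrier (suc n)
      a′ i = a (inject≤ i n<m)
      solution = vandermonde a′ (λ i≢j → distinct (i≢j ∘ inject≤-injective n<m n<m _ _)) (δ n)
      w = proj₁ solution
      moments = proj₂ solution

  -- Stepanov's method for an additive power map.

  module _ (k : ℕ) .{{_ : NonZero k}}
           (^k-homo-+ : ∀ x y → (x + y) ^ k ≈ x ^ k + y ^ k) where

    ^k-homo-- : ∀ x y → (x - y) ^ k ≈ x ^ k - y ^ k
    ^k-homo-- x y = begin
      (x - y) ^ k                    ≈⟨ //-rightDividesʳ (y ^ k) ((x - y) ^ k) ⟨
      (x - y) ^ k + y ^ k - y ^ k    ≈⟨ +-congʳ (^k-homo-+ (x - y) y) ⟨
      (x - y + y) ^ k - y ^ k        ≈⟨ +-congʳ (^-congˡ k (//-rightDividesˡ y x)) ⟩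
      x ^ k - y ^ k                  ∎

    -- Stepanov's method. Let Σ c i (a i) ^ l = [l = k] for l ≤ k, and t = ⌊D/k⌋ + 1.
    -- Then h y = Σ c i (a i ^ k − y) ^ t is a polynomial of degree at most t − 1 ≤ k
    -- in y with leading coefficient ± t. It takes the same value at the k + 1 points
    -- y = a j ^ k, because k t = D + v with 0 < v ≤ k, so that
    -- h (a j ^ k) = Σ c i (a i − a j) ^ v = [v = k].
    many-unit-differences⇒⌊D/k⌋+1≈0 :
      ∀ {D} → 0 < D → D < k ℕ.* suc k →
      (a : Vector Carrier (suc k)) → Distinct a →
      (∀ {i j} → i ≢ j → (a i - a j) ^ D ≈ 1#) →
      suc (D / k) · 1# ≈ 0#
    many-unit-differences⇒⌊D/k⌋+1≈0 {D} 0<D D<k[k+1] a distinct unit = begin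
      T                                             ≈⟨ solve 2 (λ S T → con 0 :* S :+ T :* con 1 := T) refl S T ⟨
      0# * S + T * 1#                               ≈⟨ +-cong (*-congʳ (trans (c-moments z<s) (δ-< 0<k)))
                                                              (*-congˡ (trans (c-moments (ℕ.n<1+n k)) (δ-refl k))) ⟨
      moment c a 0 * S + T * moment c a k           ≈⟨ by-rows ⟨
      ∑[ i < suc k ] ∑[ j < suc Q ] (c i * (e j * X i j))
                                                    ≈⟨ ∑-comm (λ i j → c i * (e j * X i j)) ⟩
      ∑[ j < suc Q ] ∑[ i < suc k ] (c i * (e j * X i j))
                                                    ≈⟨ by-columns ⟩
      moment e y 0 * moment c a v                   ≈⟨ vanishing ⟩
      0#                                            ∎
      where
      Q = D / k
      u = D % k
      v = k ∸ u
      T = suc Q · 1#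

      0<k : 0 < k
      0<k = ℕ.>-nonZero⁻¹ k

      Q≤k : suc Q ≤ suc k
      Q≤k = m<n*o⇒m/o<n (≡.subst (D <_) (ℕ.*-comm k (suc k)) D<k[k+1])

      0<v : 0 < v
      0<v = ℕ.m<n⇒0<n∸m (m%n<n D k)

      c-solution = vandermonde a distinct (δ k)
      c = proj₁ c-solution
      c-moments = proj₂ c-solution

      ι : Fin (suc Q) → Fin (suc k)
      ι j = inject≤ j Q≤k

      -- The sign makes each `X i j` a power of a node translated by `a i ^ k`. The weights `e` on
      -- these nodes express in dual form that h is constant.
      y : Vector Carrier (suc Q)
      y j = - (a (ι j) ^ k)

      y-distinct : Distinct y
      y-distinct {i} {j} i≢j yi≈yj =
        ^-nonzero k (λ eq → distinct (i≢j ∘ inject≤-injective Q≤k Q≤k i j) (x∙y⁻¹≈ε⇒x≈y _ _ eq))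
          (trans (^k-homo-- (a (ι i)) (a (ι j))) (x≈y⇒x∙y⁻¹≈ε (-‿injective yi≈yj)))

      e-solution = vandermonde y y-distinct (δ Q)
      e = proj₁ e-solution
      e-moments = proj₂ e-solution
      S = moment e y (suc Q)

      X : Fin (suc k) → Fin (suc Q) → Carrier
      X i j = (y j + a i ^ k) ^ suc Q

      -- The moments of `e` below order Q vanish and that of order Q is 1, so only a constant in i
      -- and a term linear in `a i ^ k` remain.
      row : ∀ i → ∑[ j < suc Q ] (e j * X i j) ≈ S + T * a i ^ k
      row i = begin
        moment e (λ j → y j + a i ^ k) (suc Q)
          ≈⟨ moment-translate-lead e y (a i ^ k) Q
               (λ j<Q → trans (e-moments (ℕ.m<n⇒m<1+n j<Q)) (δ-< j<Q)) ⟩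
        S + T * (a i ^ k * moment e y Q)
          ≈⟨ +-congˡ (*-congˡ (*-congˡ (trans (e-moments (ℕ.n<1+n Q)) (δ-refl Q)))) ⟩
        S + T * (a i ^ k * 1#)
          ≈⟨ +-congˡ (*-congˡ (*-identityʳ _)) ⟩
        S + T * a i ^ k  ∎

      by-rows : ∑[ i < suc k ] ∑[ j < suc Q ] (c i * (e j * X i j))
                  ≈ moment c a 0 * S + T * moment c a k
      by-rows = begin
        ∑[ i < suc k ] ∑[ j < suc Q ] (c i * (e j * X i j))
          ≈⟨ sum-cong-≋ (λ i → *-distribˡ-sum (c i) (λ j → e j * X i j)) ⟨
        ∑[ i < suc k ] (c i * ∑[ j < suc Q ] (e j * X i j))
          ≈⟨ sum-cong-≋ (λ i → trans (*-congˡ (row i))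
               (solve 4 (λ c S T b → c :* (S :+ T :* b) := c :* con 1 :* S :+ T :* (c :* b))
                        refl (c i) S T (a i ^ k))) ⟩
        ∑[ i < suc k ] (c i * 1# * S + T * (c i * a i ^ k))
          ≈⟨ ∑-distrib-+ (λ i → c i * 1# * S) (λ i → T * (c i * a i ^ k)) ⟩
        ∑[ i < suc k ] (c i * 1# * S) + ∑[ i < suc k ] (T * (c i * a i ^ k))
          ≈⟨ +-cong (*-distribʳ-sum S (λ i → c i * 1#)) (*-distribˡ-sum T (λ i → c i * a i ^ k)) ⟨
        moment c a 0 * S + T * moment c a k  ∎

      entry : ∀ i j → X i j ≈ (a i - a (ι j)) ^ v
      entry i j with i ≟ ι j
      -- The difference is 0 here, so its D-th power is not 1; both sides still agree because both
      -- exponents are positive.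
      ... | yes ≡.refl = begin
        (- (a i ^ k) + a i ^ k) ^ suc Q    ≈⟨ ^-congˡ (suc Q) (-‿inverseˡ _) ⟩
        0# ^ suc Q                         ≈⟨ 0^ (suc Q) z<s ⟩
        0#                                 ≈⟨ 0^ v 0<v ⟨
        0# ^ v                             ≈⟨ ^-congˡ v (-‿inverseʳ (a i)) ⟨
        (a i - a i) ^ v                    ∎
      ... | no i≢ιj = begin
        (y j + a i ^ k) ^ suc Q            ≈⟨ ^-congˡ (suc Q) (trans (+-comm _ _) (sym (^k-homo-- (a i) (a (ι j))))) ⟩
        ((a i - a (ι j)) ^ k) ^ suc Q      ≈⟨ ^-assocʳ (a i - a (ι j)) k (suc Q) ⟩
        (a i - a (ι j)) ^ (k ℕ.* suc Q)    ≈⟨ ^-congʳ (a i - a (ι j)) (next-multiple D k) ⟩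
        (a i - a (ι j)) ^ (D ℕ.+ v)        ≈⟨ ^-homo-* (a i - a (ι j)) D v ⟩
        (a i - a (ι j)) ^ D * (a i - a (ι j)) ^ v
                                           ≈⟨ trans (*-congʳ (unit i≢ιj)) (*-identityˡ _) ⟩
        (a i - a (ι j)) ^ v                ∎

      column : ∀ j → ∑[ i < suc k ] (c i * X i j) ≈ moment c a v
      column j = begin
        ∑[ i < suc k ] (c i * X i j)       ≈⟨ sum-cong-≋ (λ i → *-congˡ {c i} (entry i j)) ⟩
        moment c (λ i → a i - a (ι j)) v   ≈⟨ moment-translate c a (- a (ι j)) v (λ l<v →
                                                let l<k = ℕ.<-≤-trans l<v (ℕ.m∸n≤m k u) in
                                                trans (c-moments (ℕ.m<n⇒m<1+n l<k)) (δ-< l<k)) ⟩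
        moment c a v                       ∎

      by-columns : ∑[ j < suc Q ] ∑[ i < suc k ] (c i * (e j * X i j)) ≈ moment e y 0 * moment c a v
      by-columns = begin
        ∑[ j < suc Q ] ∑[ i < suc k ] (c i * (e j * X i j))
          ≈⟨ sum-cong-≋ (λ j → sum-cong-≋ (λ i → solve 3 (λ c e x → c :* (e :* x) := e :* (c :* x))
                                                         refl (c i) (e j) (X i j))) ⟩
        ∑[ j < suc Q ] ∑[ i < suc k ] (e j * (c i * X i j))
          ≈⟨ sum-cong-≋ (λ j → *-distribˡ-sum (e j) (λ i → c i * X i j)) ⟨
        ∑[ j < suc Q ] (e j * ∑[ i < suc k ] (c i * X i j))
          ≈⟨ sum-cong-≋ (λ j → *-cong (sym (*-identityʳ (e j))) (column j)) ⟩
        ∑[ j < suc Q ] (e j * 1# * moment c a v)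
          ≈⟨ *-distribʳ-sum (moment c a v) (λ j → e j * 1#) ⟨
        moment e y 0 * moment c a v  ∎

      -- If D < k then v = k - D lies strictly below k and the moment of `c` vanishes. Otherwise Q
      -- is positive and the moment of order 0 of `e` vanishes.
      vanishing : moment e y 0 * moment c a v ≈ 0#
      vanishing with ℕ.<-≤-connex D k
      ... | inj₁ D<k = trans (*-congˡ (trans (c-moments (ℕ.m<n⇒m<1+n v<k)) (δ-< v<k))) (zeroʳ _)
        where
        v<k : v < k
        v<k = ≡.subst (λ r → k ∸ r < k) (≡.sym (m<n⇒m%n≡m D<k)) (ℕ.∸-monoʳ-< 0<D (ℕ.<⇒≤ D<k))
      ... | inj₂ k≤D = trans (*-congʳ (trans (e-moments z<s) (δ-< (m≥n⇒m/n>0 k≤D)))) (zeroˡ _)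

-- Finite subfields: Fermat's theorem and additivity of the power |K|.

module FiniteSubfield {f ℓ s} {F : Field f ℓ} (K : Subfield F s) {n}
                      (∣K∣≡1+n : HasCardinality (Subfield.elements K) (suc n)) where
  open Field F hiding (zero)
  open FieldProperties F
  open Subfield K
  open Exp commutativeSemiring
  open Mult semiring using () renaming (_×_ to _·_)
  open Sum semiring
  open RingProperties ring
  open SemiringSolver commutativeSemiring using (solve; _:+_; _:*_; _:=_; con)
  open import Relation.Binary.Reasoning.Setoid setoid
  private module Product = CommutativeMonoidSum *-commutativeMonoid

  element : Vector Carrier (suc n)
  element i = proj₁ (Inverse.from ∣K∣≡1+n i)

  element-∈K : ∀ i → element i ∈K
  element-∈K i = proj₂ (Inverse.from ∣K∣≡1+n i)

  index : ∀ {x} → x ∈K → Fin (suc n)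
  index x∈K = Inverse.to ∣K∣≡1+n (_ , x∈K)

  index-cong : ∀ {x y} (x∈K : x ∈K) (y∈K : y ∈K) → x ≈ y → index x∈K ≡ index y∈K
  index-cong x∈K y∈K = Inverse.to-cong ∣K∣≡1+n {_ , x∈K} {_ , y∈K}

  element-index : ∀ {x} (x∈K : x ∈K) → element (index x∈K) ≈ x
  element-index x∈K = Inverse.strictlyInverseʳ ∣K∣≡1+n (_ , x∈K)

  index-element : ∀ i → index (element-∈K i) ≡ i
  index-element = Inverse.strictlyInverseˡ ∣K∣≡1+n

  element-injective : ∀ {i j} → element i ≈ element j → i ≡ j
  element-injective {i} {j} eq =
    ≡.trans (≡.sym (index-element i))
            (≡.trans (index-cong (element-∈K i) (element-∈K j) eq) (index-element j))

  element-distinct : Distinct element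
  element-distinct i≢j = i≢j ∘ element-injective

  index-of-0 : Fin (suc n)
  index-of-0 = index 0#-closed

  nonzero : Vector Carrier n
  nonzero = element ∘ punchIn index-of-0

  nonzero-≉0 : ∀ i → ¬ (nonzero i ≈ 0#)
  nonzero-≉0 i eq =
    punchInᵢ≢i index-of-0 i (element-injective (trans eq (sym (element-index 0#-closed))))

  nonzero-distinct : Distinct nonzero
  nonzero-distinct i≢j = i≢j ∘ punchIn-injective index-of-0 _ _ ∘ element-injective

  bijection⇒permutation : (g h : Carrier → Carrier) →
    (∀ {x} → x ∈K → g x ∈K) → (∀ {x} → x ∈K → h x ∈K) →
    (∀ {x y} → x ≈ y → g x ≈ g y) → (∀ {x y} → x ≈ y → h x ≈ h y) →
    (∀ x → g (h x) ≈ x) → (∀ x → h (g x) ≈ x) →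
    ∃[ π ] ∀ i → element (_⟨$⟩ʳ_ {suc n} {suc n} π i) ≈ g (element i)
  bijection⇒permutation g h g-closed h-closed g-cong h-cong gh hg =
    permutation (index ∘ g∈) (index ∘ h∈)
      (λ i → inverts (g∈ _)
               (trans (g-cong (element-index (h∈ i))) (gh _)))
      (λ i → inverts (h∈ _)
               (trans (h-cong (element-index (g∈ i))) (hg _)))
    , λ i → element-index (g∈ i)
    where
    g∈ = λ i → g-closed (element-∈K i)
    h∈ = λ i → h-closed (element-∈K i)

    inverts : ∀ {i x} (x∈K : x ∈K) → x ≈ element i → index x∈K ≡ i
    inverts {i} x∈K eq = ≡.trans (index-cong x∈K (element-∈K i) eq) (index-element i)

  -- Translation by 1 permutes K, so the sum of all elements does not change when 1 is added to
  -- each.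
  ∣K∣×1≈0 : suc n · 1# ≈ 0#
  ∣K∣×1≈0 = +-identityʳ-unique (sum element) (suc n · 1#) (sym (begin
    sum element                                   ≈⟨ sum-permute element π ⟩
    ∑[ i < suc n ] element (π ⟨$⟩ʳ i)             ≈⟨ sum-cong-≋ π-translates ⟩
    ∑[ i < suc n ] (element i + 1#)               ≈⟨ ∑-distrib-+ element (λ _ → 1#) ⟩
    sum element + ∑[ i < suc n ] 1#               ≈⟨ +-congˡ (sum-replicate (suc n)) ⟩
    sum element + suc n · 1#                      ∎))
    where
    translation = bijection⇒permutation (_+ 1#) (_- 1#)
      (λ x∈K → +-closed x∈K 1#-closed) (λ x∈K → +-closed x∈K (neg-closed 1#-closed))
      +-congʳ +-congʳ (//-rightDividesˡ 1#) (//-rightDividesʳ 1#)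
    π = proj₁ translation
    π-translates = proj₂ translation

  -- Multiplication by `x` permutes K*, so multiplying the product of K* by `x ^ n` leaves it
  -- unchanged; that product is nonzero and cancels.
  fermat : ∀ {x} → x ∈K → ¬ (x ≈ 0#) → x ^ n ≈ 1#
  fermat {x} x∈K x≉0 = *-cancelˡ-nonzero (product-≉0 nonzero nonzero-≉0) (begin
    Product.sum nonzero * x ^ n
      ≈⟨ *-comm _ _ ⟩
    x ^ n * Product.sum nonzero
      ≈⟨ *-congʳ (Product.sum-replicate n) ⟨
    Product.sum {n} (λ _ → x) * Product.sum nonzero
      ≈⟨ Product.∑-distrib-+ (λ _ → x) nonzero ⟨
    Product.sum (λ i → x * nonzero i)
      ≈⟨ Product.sum-cong-≋ ρ-scales ⟨
    Product.sum (λ i → nonzero (ρ ⟨$⟩ʳ i))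
      ≈⟨ Product.sum-permute nonzero ρ ⟨
    Product.sum nonzero
      ≈⟨ *-identityʳ _ ⟨
    Product.sum nonzero * 1#  ∎)
    where
    product-≉0 : ∀ {m} (a : Vector Carrier m) → (∀ i → ¬ (a i ≈ 0#)) → ¬ (Product.sum a ≈ 0#)
    product-≉0 {zero}  a a≉0 = 1≉0
    product-≉0 {suc m} a a≉0 = *-nonzero (a≉0 zero) (product-≉0 (a ∘ suc) (a≉0 ∘ suc))

    x⁻¹ = proj₁ (inverse x x≉0)
    xx⁻¹≈1 = proj₂ (inverse x x≉0)

    scaling = bijection⇒permutation (x *_) (x⁻¹ *_)
      (*-closed x∈K) (*-closed (inv-closed x∈K xx⁻¹≈1)) *-congˡ *-congˡ
      (λ y → trans (sym (*-assoc x x⁻¹ y)) (trans (*-congʳ xx⁻¹≈1) (*-identityˡ y)))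
      (λ y → trans (sym (*-assoc x⁻¹ x y))
               (trans (*-congʳ (trans (*-comm x⁻¹ x) xx⁻¹≈1)) (*-identityˡ y)))
    π = proj₁ scaling
    π-scales = proj₂ scaling

    π-fixes-0 : π ⟨$⟩ʳ index-of-0 ≡ index-of-0
    π-fixes-0 = element-injective (begin
      element (π ⟨$⟩ʳ index-of-0)  ≈⟨ π-scales index-of-0 ⟩
      x * element index-of-0       ≈⟨ *-congˡ (element-index 0#-closed) ⟩
      x * 0#                       ≈⟨ zeroʳ x ⟩
      0#                           ≈⟨ element-index 0#-closed ⟨
      element index-of-0           ∎)

    -- `remove` drops an index and its image; as `π` fixes the index of 0, what remains permutes the
    -- nonzero elements.
    ρ : Permutation n n
    ρ = remove index-of-0 π

    ρ-scales : ∀ i → nonzero (ρ ⟨$⟩ʳ i) ≈ x * nonzero i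
    ρ-scales i = begin
      element (punchIn index-of-0 (ρ ⟨$⟩ʳ i))
        ≡⟨ ≡.cong (λ z → element (punchIn z (ρ ⟨$⟩ʳ i))) π-fixes-0 ⟨
      element (punchIn (π ⟨$⟩ʳ index-of-0) (ρ ⟨$⟩ʳ i))
        ≡⟨ ≡.cong element (punchIn-permute π index-of-0 i) ⟨
      element (π ⟨$⟩ʳ punchIn index-of-0 i)
        ≈⟨ π-scales (punchIn index-of-0 i) ⟩
      x * nonzero i  ∎

  ^∣K∣-fixes-K : ∀ {x} → x ∈K → x ^ suc n ≈ x
  ^∣K∣-fixes-K {x} x∈K with index x∈K ≟ index-of-0
  ... | yes i≡0 = trans (^-congˡ (suc n) x≈0) (trans (zeroˡ _) (sym x≈0))
    where
    x≈0 : x ≈ 0#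
    x≈0 = trans (sym (element-index x∈K))
                (trans (reflexive (≡.cong element i≡0)) (element-index 0#-closed))
  ... | no  i≢0 = trans (*-congˡ (fermat x∈K (i≢0 ∘ index-cong x∈K 0#-closed))) (*-identityʳ x)

  -- (X + 1)^k − X^k − 1, where k = |K|, has degree less than k and vanishes on K, hence everywhere.
  ^∣K∣-homo-+1 : ∀ x → (x + 1#) ^ suc n ≈ x ^ suc n + 1#
  ^∣K∣-homo-+1 x = +-cancelʳ M X (Y + 1#) (begin
    X + M                             ≈⟨ cancel Y (X + M) ⟨
    X + M + (Y + - 1# * Y)            ≈⟨ rearrange X M Y (- 1# * Y) ⟩
    X + Y + (- 1# * Y + M)            ≈⟨ +-congˡ (moment-translate e a 1# k e-vanish) ⟨
    X + Y + (- 1# * X + moment w (λ i → element i + 1#) k)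
                                      ≈⟨ +-cong (+-comm X Y) (+-congˡ translated) ⟩
    Y + X + (- 1# * X + (M + 1#))     ≈⟨ rearrange Y (M + 1#) X (- 1# * X) ⟨
    Y + (M + 1#) + (X + - 1# * X)     ≈⟨ cancel X (Y + (M + 1#)) ⟩
    Y + (M + 1#)                      ≈⟨ solve 2 (λ Y M → Y :+ (M :+ con 1) := Y :+ con 1 :+ M) refl Y M ⟩
    Y + 1# + M                        ∎)
    where
    k = suc n
    X = (x + 1#) ^ k
    Y = x ^ k

    solution = vandermonde element element-distinct (x ^_)
    w = proj₁ solution
    w-moments = proj₂ solution
    M = moment w element k

    -- Lagrange interpolation on K minus evaluation at `x`: this annihilates all polynomials of
    -- degree less than k.
    e a : Vector Carrier (suc k)
    e = - 1# ∷ w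
    a = x ∷ element

    cancel : ∀ y z → z + (y + - 1# * y) ≈ z
    cancel y z = trans (+-congˡ (trans (+-congˡ (-1*x≈-x y)) (-‿inverseʳ y))) (+-identityʳ z)

    rearrange : ∀ x m y z → x + m + (y + z) ≈ x + y + (z + m)
    rearrange = solve 4 (λ x m y z → x :+ m :+ (y :+ z) := x :+ y :+ (z :+ m)) refl

    e-vanish : ∀ {j} → j < k → moment e a j ≈ 0#
    e-vanish {j} j<k = begin
      - 1# * x ^ j + moment w element j   ≈⟨ +-cong (-1*x≈-x _) (w-moments j<k) ⟩
      - (x ^ j) + x ^ j                   ≈⟨ -‿inverseˡ _ ⟩
      0#                                  ∎

    -- On K the k-th power is the identity, so the claim is evident there; the extra `1#` is the
    -- moment of order 0, namely `x ^ 0`.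
    translated : moment w (λ i → element i + 1#) k ≈ M + 1#
    translated = begin
      ∑[ i < k ] (w i * (element i + 1#) ^ k)
        ≈⟨ sum-cong-≋ (λ i → *-congˡ {w i} (trans (^∣K∣-fixes-K (+-closed (element-∈K i) 1#-closed))
                                                  (+-congʳ (sym (^∣K∣-fixes-K (element-∈K i)))))) ⟩
      ∑[ i < k ] (w i * (element i ^ k + 1#))
        ≈⟨ sum-cong-≋ (λ i → distribˡ (w i) (element i ^ k) 1#) ⟩
      ∑[ i < k ] (w i * element i ^ k + w i * 1#)
        ≈⟨ ∑-distrib-+ (λ i → w i * element i ^ k) (λ i → w i * 1#) ⟩
      M + moment w element 0
        ≈⟨ +-congˡ (w-moments z<s) ⟩
      M + 1#  ∎

  -- By homogeneity: for nonzero `y`, write x = y z and take out the factor `y ^ k`, which leaves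
  -- the case of z + 1.
  ^∣K∣-homo-+ : Decidable _≈_ → ∀ x y → (x + y) ^ suc n ≈ x ^ suc n + y ^ suc n
  ^∣K∣-homo-+ _≟F_ x y with y ≟F 0#
  ... | yes y≈0 = begin
    (x + y) ^ suc n          ≈⟨ ^-congˡ (suc n) (trans (+-congˡ y≈0) (+-identityʳ x)) ⟩
    x ^ suc n                ≈⟨ +-identityʳ _ ⟨
    x ^ suc n + 0#           ≈⟨ +-congˡ (trans (^-congˡ (suc n) y≈0) (zeroˡ _)) ⟨
    x ^ suc n + y ^ suc n    ∎
  ... | no  y≉0 = begin
    (x + y) ^ k              ≈⟨ ^-congˡ k (trans (+-congʳ x≈yz) (solve 2 (λ y z → y :* z :+ y := y :* (z :+ con 1)) refl y z)) ⟩
    (y * (z + 1#)) ^ k       ≈⟨ ^-distrib-* y (z + 1#) k ⟩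
    y ^ k * (z + 1#) ^ k     ≈⟨ *-congˡ (^∣K∣-homo-+1 z) ⟩
    y ^ k * (z ^ k + 1#)     ≈⟨ trans (distribˡ _ _ _) (+-congˡ (*-identityʳ _)) ⟩
    y ^ k * z ^ k + y ^ k    ≈⟨ +-congʳ (trans (^-congˡ k x≈yz) (^-distrib-* y z k)) ⟨
    x ^ k + y ^ k            ∎
    where
    k = suc n
    z = proj₁ (inverse y y≉0) * x

    x≈yz : x ≈ y * z
    x≈yz = trans (sym (*-identityˡ x))
             (trans (*-congʳ (sym (proj₂ (inverse y y≉0)))) (*-assoc y _ x))

-- The whole finite field and its d-th powers.

module _ {f ℓ} (F : Field f ℓ) where
  open Field F

  -- Regarding F as its own subfield transfers the results on finite subfields to F.
  whole : Subfield F 0ℓ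
  whole = record
    { _∈K        = λ _ → ⊤
    ; resp       = _
    ; 0#-closed  = _
    ; 1#-closed  = _
    ; +-closed   = _
    ; neg-closed = _
    ; *-closed   = _
    ; inv-closed = _
    }

  whole-cardinality : ∀ {q} → HasCardinality setoid q → HasCardinality (Subfield.elements whole) q
  whole-cardinality ∣F∣≡q = record
    { to        = λ x → to (proj₁ x)
    ; from      = λ i → from i , _
    ; to-cong   = to-cong
    ; from-cong = from-cong
    ; inverse   = inverseˡ , inverseʳ
    }
    where open Inverse ∣F∣≡q

module FiniteField {f ℓ} (F : Field f ℓ) {n} (∣F∣≡1+n : HasCardinality (Field.setoid F) (suc n)) where
  open Field F hiding (zero)
  open FieldProperties F
  private module Whole = FiniteSubfield (whole F) (whole-cardinality F ∣F∣≡1+n)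
  open Whole public
    using () renaming ( nonzero to unit; nonzero-≉0 to unit-≉0; nonzero-distinct to unit-distinct
                      ; ∣K∣×1≈0 to ∣F∣×1≈0)
  open Exp commutativeSemiring
  open Sum semiring
  open SemiringSolver commutativeSemiring using (solve; _:+_; _:*_; _:=_; con)
  open RingProperties ring
  open import Relation.Binary.Reasoning.Setoid setoid

  _≟F_ : Decidable _≈_
  x ≟F y = map′ (λ eq → trans (sym (Whole.element-index {x} _))
                         (trans (reflexive (≡.cong Whole.element eq)) (Whole.element-index {y} _)))
                (Whole.index-cong _ _)
                (Whole.index {x} _ ≟ Whole.index {y} _)

  x^[∣F∣-1]≈1 : ∀ {x} → ¬ (x ≈ 0#) → x ^ n ≈ 1#
  x^[∣F∣-1]≈1 = Whole.fermat _

  power⇒unit-power : ∀ d D {x} → d ℕ.* D ≡ n → IsNonzeroPower F d x → x ^ D ≈ 1#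
  power⇒unit-power d D {x} dD≡n (y , y≉0 , x≈y^d) = begin
    x ^ D          ≈⟨ ^-congˡ D x≈y^d ⟩
    (y ^ d) ^ D    ≈⟨ ^-assocʳ y d D ⟩
    y ^ (d ℕ.* D)  ≈⟨ ^-congʳ y dD≡n ⟩
    y ^ n          ≈⟨ x^[∣F∣-1]≈1 y≉0 ⟩
    1#             ∎

  -- If x is not a d-th power, divide weights c on the units whose moments are 1, 0, …, 0
  -- by u^d − x. The moments s j of order j d of the quotients satisfy
  -- s (j + 1) = x s j + [j = 0], which contradicts the periodicity s D = s 0.
  unit-power⇒power : ∀ d D {x} → 0 < d → suc D ℕ.* d ≡ n → x ^ suc D ≈ 1# → IsNonzeroPower F d x
  unit-power⇒power d D {x} 0<d Dd≡n x^D≈1 with any? (λ i → x ≟F (unit i ^ d))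
  ... | yes (i , x≈u^d) = unit i , unit-≉0 i , x≈u^d
  ... | no  ∄root = contradiction x^D≈0 (λ eq → 1≉0 (trans (sym x^D≈1) (trans (*-congˡ eq) (zeroʳ x))))
    where
    gap : ∀ i → ∃[ v ] ((unit i ^ d - x) * v ≈ 1#)
    gap i = inverse (unit i ^ d - x) (λ eq → ∄root (i , sym (x∙y⁻¹≈ε⇒x≈y _ _ eq)))

    0<n : 0 < n
    0<n = ≡.subst (0 <_) Dd≡n (ℕ.<-≤-trans 0<d (ℕ.m≤m+n d (D ℕ.* d)))

    solution = vandermonde unit unit-distinct (δ 0)
    c w : Vector Carrier n
    c = proj₁ solution
    w i = c i * proj₁ (gap i)

    s : ℕ → Carrier
    s j = moment w unit (j ℕ.* d)

    s-suc : ∀ j → s (suc j) ≈ x * s j + moment c unit (j ℕ.* d)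
    s-suc j = begin
      ∑[ i < n ] (w i * unit i ^ (d ℕ.+ j ℕ.* d))
        ≈⟨ sum-cong-≋ term ⟩
      ∑[ i < n ] (x * (w i * unit i ^ (j ℕ.* d)) + c i * unit i ^ (j ℕ.* d))
        ≈⟨ ∑-distrib-+ (λ i → x * (w i * unit i ^ (j ℕ.* d))) (λ i → c i * unit i ^ (j ℕ.* d)) ⟩
      ∑[ i < n ] (x * (w i * unit i ^ (j ℕ.* d))) + moment c unit (j ℕ.* d)
        ≈⟨ +-congʳ (*-distribˡ-sum x (λ i → w i * unit i ^ (j ℕ.* d))) ⟨
      x * s j + moment c unit (j ℕ.* d)  ∎
      where
      term : ∀ i → w i * unit i ^ (d ℕ.+ j ℕ.* d)
                   ≈ x * (w i * unit i ^ (j ℕ.* d)) + c i * unit i ^ (j ℕ.* d)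
      term i = begin
        c i * v * unit i ^ (d ℕ.+ j ℕ.* d)
          ≈⟨ *-congˡ (^-homo-* (unit i) d (j ℕ.* d)) ⟩
        c i * v * (unit i ^ d * U)
          ≈⟨ *-congˡ (*-congʳ (//-rightDividesˡ x (unit i ^ d))) ⟨
        c i * v * ((unit i ^ d - x + x) * U)
          ≈⟨ solve 5 (λ c v e x U → c :* v :* ((e :+ x) :* U)
                                    := x :* (c :* v :* U) :+ (e :* v) :* (c :* U))
                     refl (c i) v (unit i ^ d - x) x U ⟩
        x * (c i * v * U) + ((unit i ^ d - x) * v) * (c i * U)
          ≈⟨ +-congˡ (trans (*-congʳ (proj₂ (gap i))) (*-identityˡ _)) ⟩
        x * (c i * v * U) + c i * U  ∎
        where
        v = proj₁ (gap i)
        U = unit i ^ (j ℕ.* d)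

    -- The recursion is homogeneous from `s 1` on: for 0 < j ≤ D the order j d lies strictly between
    -- 0 and n, where the moments of `c` vanish.
    s-closed : ∀ {j} → j ≤ D → s (suc j) ≈ x ^ j * s 1
    s-closed {zero}  _   = sym (*-identityˡ _)
    s-closed {suc j} j<D = begin
      s (suc (suc j))
        ≈⟨ s-suc (suc j) ⟩
      x * s (suc j) + moment c unit (suc j ℕ.* d)
        ≈⟨ +-cong (*-congˡ (s-closed (ℕ.<⇒≤ j<D)))
                  (trans (proj₂ solution jd<n) (δ0-pos (ℕ.<-≤-trans 0<d (ℕ.m≤m+n d (j ℕ.* d))))) ⟩
      x * (x ^ j * s 1) + 0#
        ≈⟨ trans (+-identityʳ _) (sym (*-assoc x _ _)) ⟩
      x ^ suc j * s 1  ∎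
      where
      jd<n : suc j ℕ.* d < n
      jd<n = ≡.subst (suc j ℕ.* d <_) Dd≡n
               (ℕ.*-monoˡ-< d {{ℕ.>-nonZero 0<d}} (s<s j<D))

      δ0-pos : ∀ {l} → 0 < l → δ 0 l ≈ 0#
      δ0-pos {suc l} _ = refl

    s-periodic : s (suc D) ≈ s 0
    s-periodic = begin
      moment w unit (suc D ℕ.* d)    ≡⟨ ≡.cong (moment w unit) Dd≡n ⟩
      moment w unit n                ≈⟨ moment-const w unit n (λ i → x^[∣F∣-1]≈1 (unit-≉0 i)) ⟩
      moment w unit 0 * 1#           ≈⟨ *-identityʳ _ ⟩
      s 0                            ∎

    x^D≈0 : x ^ D ≈ 0#
    x^D≈0 = +-identityʳ-unique (s 0) (x ^ D) (begin
      s 0 + x ^ D                           ≈⟨ +-congʳ (trans (*-congʳ x^D≈1) (*-identityˡ _)) ⟨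
      x ^ suc D * s 0 + x ^ D               ≈⟨ solve 3 (λ x A s → x :* A :* s :+ A := A :* (x :* s :+ con 1)) refl x (x ^ D) (s 0) ⟩
      x ^ D * (x * s 0 + 1#)                ≈⟨ *-congˡ (trans (s-suc 0) (+-congˡ (proj₂ solution 0<n))) ⟨
      x ^ D * s 1                           ≈⟨ s-closed ℕ.≤-refl ⟨
      s (suc D)                             ≈⟨ s-periodic ⟩
      s 0                                   ∎)

open import Data.Nat.Base using (_*_; _+_; _^_)

-- The condition on the remainder.

-- The quotient ⌊D/k⌋ is then -1 modulo p, so D lies in the last of the p blocks of length k that
-- make up a period p k.
∣1+⌊D/k⌋⇒[p∸1]k≤D%pk : ∀ p D k .{{_ : NonZero k}} .{{_ : NonZero (p * k)}} →
                         p ∣ suc (D / k) → (p ∸ 1) * k ≤ D % (p * k)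
∣1+⌊D/k⌋⇒[p∸1]k≤D%pk zero    D k p∣t = z≤n
∣1+⌊D/k⌋⇒[p∸1]k≤D%pk (suc p) D k (divides (suc e) 1+D/k≡) = begin
  p * k                                      ≤⟨ ℕ.m≤n+m (p * k) (D % k) ⟩
  D % k + p * k                              ≡⟨ m<n⇒m%n≡m (ℕ.+-monoˡ-< (p * k) (m%n<n D k)) ⟨
  (D % k + p * k) % (suc p * k)              ≡⟨ [m+kn]%n≡m%n (D % k + p * k) e (suc p * k) ⟨
  (D % k + p * k + e * (suc p * k)) % (suc p * k)
                                             ≡⟨ ≡.cong (_% (suc p * k)) D≡ ⟨
  D % (suc p * k)                            ∎
  where
  open ℕ.≤-Reasoning
  D≡ : D ≡ D % k + p * k + e * (suc p * k)
  D≡ = begin-equality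
    D                                        ≡⟨ m≡m%n+[m/n]*n D k ⟩
    D % k + D / k * k                        ≡⟨ ≡.cong (λ Q → D % k + Q * k) (ℕ.suc-injective 1+D/k≡) ⟩
    D % k + (p + e * suc p) * k              ≡⟨ ≡.cong (D % k +_) (ℕ.*-distribʳ-+ k p (e * suc p)) ⟩
    D % k + (p * k + e * suc p * k)          ≡⟨ ℕ.+-assoc (D % k) (p * k) (e * suc p * k) ⟨
    D % k + p * k + e * suc p * k            ≡⟨ ≡.cong (D % k + p * k +_) (ℕ.*-assoc e (suc p) k) ⟩
    D % k + p * k + e * (suc p * k)          ∎

-- The clique K and the bound for all cliques, with N = q - 1 and n = |K| - 1.

module PaleyClique {f ℓ s} {F : Field f ℓ} {N n}
                   (∣F∣≡1+N : HasCardinality (Field.setoid F) (suc N))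
                   (K : Subfield F s) (∣K∣≡1+n : HasCardinality (Subfield.elements K) (suc n))
                   .{{_ : NonZero N}} .{{_ : NonZero n}} (d : ℕ) .{{_ : NonZero d}}
                   (d∣N/n : d ∣ N / n) where
  open Field F hiding (zero; _+_; _*_)
  open FieldProperties F
  open FiniteField F ∣F∣≡1+N
  open FiniteSubfield K ∣K∣≡1+n
  open Subfield K
  open Exp commutativeSemiring using (^-congˡ; ^-congʳ; ^-assocʳ) renaming (_^_ to _^F_)
  open Mult semiring using (×-congˡ) renaming (_×_ to _·_)
  open import Relation.Binary.Reasoning.Setoid setoid

  -- The elements of K* are |K| − 1 roots of X^g − 1 for g = gcd (q − 1) (|K| − 1).
  n∣N : n ∣ N
  n∣N = ≡.subst (_∣ N) (ℕ.≤-antisym (∣⇒≤ (gcd[m,n]∣n N n)) n≤gcd) (gcd[m,n]∣m N n)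
    where
    n≤gcd : n ≤ gcd N n
    n≤gcd = roots≤exponent nonzero nonzero-distinct (ℕ.n≢0⇒n>0 (gcd[m,n]≢0 N n (inj₁ (≢-nonZero⁻¹ N))))
      (λ i → gcd-kills *-monoid N n (x^[∣F∣-1]≈1 (nonzero-≉0 i)) (fermat (element-∈K _) (nonzero-≉0 i)))

  D : ℕ
  D = N / d

  e : ℕ
  e = _∣_.quotient d∣N/n

  N≡[e*n]*d : N ≡ e * n * d
  N≡[e*n]*d = ≡.trans (≡.sym (m/n*n≡m n∣N)) (≡.trans (≡.cong (_* n) (_∣_.equality d∣N/n))
    (≡.trans (ℕ.*-assoc e d n) (≡.trans (≡.cong (e *_) (ℕ.*-comm d n)) (≡.sym (ℕ.*-assoc e n d)))))

  -- The hypothesis on `d` in the form used for K: since `n` divides `D`, elements of K* are D-th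
  -- roots of unity, hence d-th powers.
  D≡e*n : D ≡ e * n
  D≡e*n = ≡.trans (≡.cong (_/ d) N≡[e*n]*d) (m*n/n≡m (e * n) d)

  D*d≡N : D * d ≡ N
  D*d≡N = ≡.trans (≡.cong (_* d) D≡e*n) (≡.sym N≡[e*n]*d)

  0<D : 0 < D
  0<D = ℕ.n≢0⇒n>0 (λ D≡0 → ≢-nonZero⁻¹ N (≡.trans (≡.sym D*d≡N) (≡.cong (_* d) D≡0)))

  K-clique : Clique (GP F d) (suc n)
  K-clique = record
    { vertex    = element
    ; injective = element-injective
    ; adjacent  = λ {i} {j} i≢j → difference-is-power (element i - element j)
        (+-closed (element-∈K i) (neg-closed (element-∈K j)))
        (λ eq → element-distinct i≢j (x∙y⁻¹≈ε⇒x≈y _ _ eq))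
        D ≡.refl
    }
    where
    open RingProperties ring using (x∙y⁻¹≈ε⇒x≈y)

    -- The exponent is generalised to `D′` so that it can be matched against a successor.
    difference-is-power : ∀ x → x ∈K → ¬ (x ≈ 0#) → ∀ D′ → D′ ≡ D → IsNonzeroPower F d x
    difference-is-power x x∈K x≉0 zero     0≡D = contradiction 0≡D (ℕ.<⇒≢ 0<D)
    difference-is-power x x∈K x≉0 (suc D′) eq  =
      unit-power⇒power d D′ (>-nonZero⁻¹ d) (≡.trans (≡.cong (_* d) eq) D*d≡N) (begin
        x ^F suc D′      ≈⟨ ^-congʳ x (≡.trans eq (≡.trans D≡e*n (ℕ.*-comm e n))) ⟩
        x ^F (n * e)     ≈⟨ ^-assocʳ x n e ⟨
        (x ^F n) ^F e    ≈⟨ ^-congˡ e (fermat x∈K x≉0) ⟩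
        1# ^F e          ≈⟨ 1^ e ⟩
        1#               ∎)

  -- Any k + 1 vertices of a larger clique would have differences that are D-th roots of unity, with
  -- D < k (k + 1) by the bound on q; Stepanov's method then makes ⌊D/k⌋ + 1 vanish in F.
  clique-bound : suc N < d * suc n * (suc n + 1) → ¬ (suc (D / suc n) · 1# ≈ 0#) →
                 ∀ m → Clique (GP F d) m → m ≤ suc n
  clique-bound q<dk[k+1] t≉0 m clique = ℕ.≮⇒≥ λ k<m →
    let ι = λ (i : Fin (suc (suc n))) → inject≤ i k<m
        ι-≢ = λ {i j} (i≢j : i ≢ j) → i≢j ∘ inject≤-injective k<m k<m i j
    in t≉0 (many-unit-differences⇒⌊D/k⌋+1≈0 (suc n) (^∣K∣-homo-+ _≟F_) 0<D D<k[k+1]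
      (vertex ∘ ι)
      (λ i≢j → ι-≢ i≢j ∘ injective)
      (λ i≢j → power⇒unit-power d D (≡.trans (ℕ.*-comm d D) D*d≡N) (adjacent (ι-≢ i≢j))))
    where
    open Clique clique
    k = suc n

    D<k[k+1] : D < k * suc k
    D<k[k+1] = m<n*o⇒m/o<n (ℕ.<-trans (ℕ.n<1+n N) (≡.subst (suc N <_) dk[k+1]≡ q<dk[k+1]))
      where
      dk[k+1]≡ : d * k * (k + 1) ≡ k * suc k * d
      dk[k+1]≡ = ≡.trans (≡.cong (d * k *_) (ℕ.+-comm k 1))
                   (≡.trans (ℕ.*-assoc d k (suc k)) (ℕ.*-comm d (k * suc k)))

  -- Either p is nonzero in F, and then so is q = p^r, which is absurd; or p and `t` both vanish in
  -- F, hence so does their gcd, which is 1 because p is prime and does not divide `t`.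
  ×1≉0 : ∀ {p t} r → Prime p → suc N ≡ p ^ r → ¬ (p ∣ t) → ¬ (t · 1# ≈ 0#)
  ×1≉0 {p} {t} r p-prime q≡p^r p∤t t≈0 with (p · 1#) ≟F 0#
  ... | no  p≉0 = ×1-^-nonzero p r p≉0 (trans (×-congˡ (≡.sym q≡p^r)) ∣F∣×1≈0)
  ... | yes p≈0 with prime⇒irreducible p-prime (gcd[m,n]∣m p t)
  ...   | inj₁ gcd≡1 = 1≉0 (trans (sym (trans (×-congˡ gcd≡1) (+-identityʳ 1#))) (gcd-kills +-monoid p t p≈0 t≈0))
  ...   | inj₂ gcd≡p = p∤t (≡.subst (_∣ t) gcd≡p (gcd[m,n]∣n p t))

proposition4p1 :
    {c ℓ s : Level} (p q k d : ℕ) → (p-prime : Prime p) → p ≢ 2 → (∃[ n ] q ≡ p ^ n) →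
    (F : Field c ℓ) → HasCardinality (Field.setoid F) q →
    (K : Subfield F s) → Subfield.IsProper K → (∣K∣≡k : HasCardinality (Subfield.elements K) k) →
    (2≤d : 2 ≤ d) →
    let instance
          k∸1≢0 = cardinality∸1≢0 K ∣K∣≡k
          p*k≢0 = p*cardinality≢0 K p-prime ∣K∣≡k
          d≢0   = >-nonZero (<⇒≤ 2≤d)
    in
    d ∣ (q ∸ 1) / (k ∸ 1) →
    q < d * k * (k + 1) →
    ((q ∸ 1) / d) % (p * k) < (p ∸ 1) * k →
    HasCliqueNumber (GP F d) k
proposition4p1 p zero k d _ _ _ F ∣F∣≡0 _ _ _ _ _ _ _ =
  contradiction (Inverse.to ∣F∣≡0 (Field.0# F)) λ ()
proposition4p1 p (suc N) zero d _ _ _ F _ K _ ∣K∣≡0 _ _ _ _ =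
  contradiction (Inverse.to ∣K∣≡0 (_ , Subfield.0#-closed K)) λ ()
proposition4p1 p (suc N) (suc n) d p-prime _ (r , q≡p^r) F ∣F∣≡q K _ ∣K∣≡k 2≤d d∣M q<dk[k+1] r<[p∸1]k =
  K-clique , clique-bound q<dk[k+1] (×1≉0 r p-prime q≡p^r λ p∣t →
    ℕ.<⇒≱ r<[p∸1]k (∣1+⌊D/k⌋⇒[p∸1]k≤D%pk p D (suc n) p∣t))
  where
  instance
    N≢0   = cardinality∸1≢0 (whole F) (whole-cardinality F ∣F∣≡q)
    n≢0   = cardinality∸1≢0 K ∣K∣≡k
    d≢0   = >-nonZero (<⇒≤ 2≤d)
    p*k≢0 = p*cardinality≢0 K p-prime ∣K∣≡k
  open PaleyClique ∣F∣≡q K ∣K∣≡k d d∣M
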